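{- Let $G=(V,E,\omega)$ be a finite directed non-negatively weighted graph, $r\in V$ a root and $k\ge 1$ an integer. Algorithm Exh-S-kSSP (described in the context), run on input $(G,r,k)$, solves the Single-Source Top-$k$ Simple Shortest Paths problem: at termination, for every $v\in V\setminus\{r\}$ the list $T_v$ is a collection of top-$k$ simple shortest paths from $r$ to $v$.
   Context: $G=(V,E,\omega)$ is a finite directed graph, $E\subseteq V\times V$, with non-negative real edge weights $\omega$; $N^+(v)=\{u:(v,u)\in E\}$. A path from $s$ to $t$ is a vertex sequence $P=(s=v_1,\dots,v_\eta=t)$, $\eta\ge 1$, with $(v_i,v_{i+1})\in E$ for all $i<\eta$; $V(P)$ is its vertex set; it is simple if it has no repeated vertex; its weight is $\omega(P)=\sum_{i=1}^{\eta-1}\omega(v_i,v_{i+1})$. For a path $\Pi$ ending at $v$ and an edge $(v,u)$, $\Pi\oplus(u)$ is $\Pi$ extended by $u$. A collection of top-$k$ simple shortest paths from $r$ to $v$ is a set of pairwise distinct simple paths from $r$ to $v$ that contains all simple $r$–$v$ paths if there are fewer than $k$ of them, and otherwise contains exactly $k$ simple $r$–$v$ paths such that every simple $r$–$v$ path not in the set has weight at least that of every path in the set. The Single-Source Top-$k$ Simple Shortest Paths problem asks for such a collection for each $v\in V\setminus\{r\}$. Algorithm Exh-S-kSSP. Maintain a list $T_v$ for each $v\in V$ (initially empty) and a min-priority queue $PQ$ of paths keyed by weight, initially containing only the trivial path $(r)$ with key $0$. While $PQ\ne\emptyset$: remove from $PQ$ a path $\Pi=(r,\dots,v)$ of minimum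 weight; for each $u\in N^+(v)\setminus V(\Pi)$ insert $\Pi\oplus(u)$ into $PQ$ with key $\omega(\Pi)+\omega(v,u)$; if $|T_v|<k$, add $\Pi$ to $T_v$. -}

module Defs where

open import Data.Bool using (Bool; T)
open import Data.Fin using (Fin)
import Data.Fin.Properties as Fin
open import Data.List using (List; []; _∷_; [_]; _++_; _∷ʳ_; length; mapMaybe; allFin)
import Data.List.Membership.DecPropositional as DecMembership
open import Data.List.Membership.Propositional using (_∈_; _∉_)
open import Data.List.Relation.Binary.Permutation.Propositional using (_↭_)
open import Data.List.Relation.Unary.All using (All)
open import Data.List.Relation.Unary.Unique.Propositional using (Unique)
open import Data.Maybe using (Maybe; just; nothing)
open import Data.Nat using (ℕ; _<_; _<?_; _⊔_) renaming (_≤_ to _≤ℕ_)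
import Data.Nat.Properties as ℕ
open import Data.Product using (∃; _×_; _,_)
open import Data.Rational as ℚ using (ℚ; 0ℚ; ½)
import Data.Rational.Properties as ℚ
open import Data.Rational.Solver using (module +-*-Solver)
open import Data.Sum using (_⊎_)
open import Function using (flip)
open import Induction.WellFounded using (Acc)
open import Relation.Binary.Construct.Closure.ReflexiveTransitive using (Star)
open import Relation.Binary.PropositionalEquality using (_≡_; _≢_; refl; sym; trans; cong; subst)
open import Relation.Nullary using (¬_; yes; no)
open import Relation.Nullary.Decidable using (T?)

-- Real numbers as Cauchy sequences of rationals.  Two representatives x, y
-- denote the same real when x ≤ y and y ≤ x.

IsCauchy : (ℕ → ℚ) → Set
IsCauchy x = ∀ ε → 0ℚ ℚ.< ε →
  ∃ λ N → ∀ m n → N ≤ℕ m → N ≤ℕ n → ℚ.∣ x m ℚ.- x n ∣ ℚ.< ε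

record ℝ : Set where
  constructor mkℝ
  field
    seq    : ℕ → ℚ
    cauchy : IsCauchy seq

open ℝ public

infix 4 _≤_

_≤_ : ℝ → ℝ → Set
x ≤ y = ∀ ε → 0ℚ ℚ.< ε → ∃ λ N → ∀ n → N ≤ℕ n → seq x n ℚ.≤ seq y n ℚ.+ ε

0ℝ : ℝ
0ℝ = mkℝ (λ _ → 0ℚ) λ ε 0<ε → 0 , λ _ _ _ _ → 0<ε

½ε>0 : ∀ {ε} → 0ℚ ℚ.< ε → 0ℚ ℚ.< ½ ℚ.* ε
½ε>0 {ε} 0<ε = subst (ℚ._< ½ ℚ.* ε) (ℚ.*-zeroʳ ½) (ℚ.*-monoʳ-<-pos ½ 0<ε)

½ε+½ε≡ε : ∀ ε → ½ ℚ.* ε ℚ.+ ½ ℚ.* ε ≡ ε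
½ε+½ε≡ε ε = trans (sym (ℚ.*-distribʳ-+ ε ½ ½)) (ℚ.*-identityˡ ε)

+-cauchy : ∀ {x y} → IsCauchy x → IsCauchy y → IsCauchy (λ n → x n ℚ.+ y n)
+-cauchy {x} {y} cx cy ε 0<ε with cx (½ ℚ.* ε) (½ε>0 0<ε) | cy (½ ℚ.* ε) (½ε>0 0<ε)
... | M , hx | N , hy = M ⊔ N , bound
  where
  open ℚ.≤-Reasoning

  regroup : ∀ a b c d → (a ℚ.+ b) ℚ.- (c ℚ.+ d) ≡ (a ℚ.- c) ℚ.+ (b ℚ.- d)
  regroup = solve 4 (λ a b c d → (a :+ b) :- (c :+ d) := (a :- c) :+ (b :- d)) refl
    where open +-*-Solver

  bound : ∀ m n → M ⊔ N ≤ℕ m → M ⊔ N ≤ℕ n →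
          ℚ.∣ (x m ℚ.+ y m) ℚ.- (x n ℚ.+ y n) ∣ ℚ.< ε
  bound m n m≥ n≥ = begin-strict
    ℚ.∣ (x m ℚ.+ y m) ℚ.- (x n ℚ.+ y n) ∣
      ≡⟨ cong ℚ.∣_∣ (regroup (x m) (y m) (x n) (y n)) ⟩
    ℚ.∣ (x m ℚ.- x n) ℚ.+ (y m ℚ.- y n) ∣
      ≤⟨ ℚ.∣p+q∣≤∣p∣+∣q∣ (x m ℚ.- x n) (y m ℚ.- y n) ⟩
    ℚ.∣ x m ℚ.- x n ∣ ℚ.+ ℚ.∣ y m ℚ.- y n ∣
      <⟨ ℚ.+-mono-< (hx m n (ℕ.m⊔n≤o⇒m≤o M N m≥) (ℕ.m⊔n≤o⇒m≤o M N n≥))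
                    (hy m n (ℕ.m⊔n≤o⇒n≤o M N m≥) (ℕ.m⊔n≤o⇒n≤o M N n≥)) ⟩
    ½ ℚ.* ε ℚ.+ ½ ℚ.* ε
      ≡⟨ ½ε+½ε≡ε ε ⟩
    ε ∎

infixl 6 _+_

_+_ : ℝ → ℝ → ℝ
x + y = mkℝ (λ n → seq x n ℚ.+ seq y n) (+-cauchy {seq x} {seq y} (cauchy x) (cauchy y))

-- The vertex set is Fin n and E ⊆ V × V is given by its indicator function,
-- so Edge v u has at most one inhabitant.

record WeightedDigraph (n : ℕ) : Set where
  field
    E : Fin n → Fin n → Bool

  Edge : Fin n → Fin n → Set
  Edge v u = T (E v u)

  field
    ω        : ∀ {v u} → Edge v u → ℝ
    ω-nonNeg : ∀ {v u} (e : Edge v u) → 0ℝ ≤ ω e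

module _ {n : ℕ} (G : WeightedDigraph n) where
  open WeightedDigraph G

  infixl 5 _⊕_

  -- Since edge witnesses are unique, propositional equality of paths is
  -- equality of their vertex sequences.
  data Path (s : Fin n) : Fin n → Set where
    trivial : Path s s
    _⊕_     : ∀ {v u} → Path s v → Edge v u → Path s u

module _ {n : ℕ} {G : WeightedDigraph n} where
  open WeightedDigraph G

  vertices : ∀ {s t} → Path G s t → List (Fin n)
  vertices {s}     trivial = [ s ]
  vertices {_} {t} (Π ⊕ _) = vertices Π ∷ʳ t

  Simple : ∀ {s t} → Path G s t → Set
  Simple P = Unique (vertices P)

  weight : ∀ {s t} → Path G s t → ℝ
  weight trivial = 0ℝ
  weight (Π ⊕ e) = weight Π + ω e

module _ {n : ℕ} (G : WeightedDigraph n) where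

  FewerSimplePathsThan : ℕ → Fin n → Fin n → Set
  FewerSimplePathsThan k r v =
    (Ps : List (Path G r v)) → Unique Ps → All Simple Ps → length Ps < k

  record IsTopKSimpleShortestPaths (k : ℕ) (r v : Fin n) (Ps : List (Path G r v)) : Set where
    field
      distinct : Unique Ps
      simple   : All Simple Ps
      topK     :
        (FewerSimplePathsThan k r v × (∀ P → Simple P → P ∈ Ps))
        ⊎
        (¬ FewerSimplePathsThan k r v
          × length Ps ≡ k
          × (∀ P → Simple P → P ∉ Ps → ∀ Q → Q ∈ Ps → weight Q ≤ weight P))

-- Exh-S-kSSP as a transition system: one step is one iteration of the while
-- loop.  The queue is a list read up to permutation, and ties between paths of
-- minimum key may be broken arbitrarily.

module ExhSkSSP {n : ℕ} (G : WeightedDigraph n) (r : Fin n) (k : ℕ) where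
  open WeightedDigraph G
  open DecMembership (Fin._≟_ {n}) using (_∈?_)

  record Entry : Set where
    constructor entry
    field
      {end} : Fin n
      path  : Path G r end
      key   : ℝ

  open Entry public

  Lists : Set
  Lists = (v : Fin n) → List (Path G r v)

  record State : Set where
    constructor ⟨_,_⟩
    field
      lists : Lists
      queue : List Entry

  open State public

  initial : State
  initial = ⟨ (λ _ → []) , [ entry trivial 0ℝ ] ⟩

  extension : ∀ {v} → Path G r v → Fin n → Maybe Entry
  extension {v} Π u with T? (E v u) | u ∈? vertices Π
  ... | yes e | no _  = just (entry (Π ⊕ e) (weight Π + ω e))
  ... | yes _ | yes _ = nothing
  ... | no _  | _     = nothing

  extensions : ∀ {v} → Path G r v → List Entry
  extensions Π = mapMaybe (extension Π) (allFin n)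

  addIfShort : ∀ {v} → Path G r v → List (Path G r v) → List (Path G r v)
  addIfShort Π Ps with length Ps <? k
  ... | yes _ = Ps ∷ʳ Π
  ... | no _  = Ps

  recordPath : ∀ {v} → Path G r v → Lists → Lists
  recordPath {v} Π Ts u with v Fin.≟ u
  ... | yes refl = addIfShort Π (Ts u)
  ... | no _     = Ts u

  infix 4 _⟶_ _⟶*_

  data _⟶_ : State → State → Set where
    iterate : ∀ {Ts q rest v} {Π : Path G r v} {κ} →
              q ↭ entry Π κ ∷ rest →
              All (λ e → κ ≤ key e) rest →
              ⟨ Ts , q ⟩ ⟶ ⟨ recordPath Π Ts , extensions Π ++ rest ⟩

  _⟶*_ : State → State → Set
  _⟶*_ = Star _⟶_

  Terminates : Set
  Terminates = Acc (flip _⟶_) initial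

  -- The order of ℝ is not decidable, so that a minimum of a nonempty queue
  -- exists is asserted in double-negated form.
  NeverStuck : Set
  NeverStuck = ∀ {s} → initial ⟶* s → queue s ≢ [] → ¬ ¬ ∃ λ s′ → s ⟶ s′

  CorrectAtTermination : Set
  CorrectAtTermination = ∀ {s} → initial ⟶* s → queue s ≡ [] →
    ∀ v → v ≢ r → IsTopKSimpleShortestPaths G k r v (lists s v)

{-# OPTIONS --safe #-}

-- Every simple path from r is at each moment either already recorded or
-- rightly discarded, or has a prefix waiting in the queue.  Weights being
-- non-negative, the recorded paths weigh no more than any queued one, so a
-- path popped when its list is full is dominated by that list.  Queued paths
-- are pairwise incomparable for the prefix order, hence no path is popped
-- twice.  A queued path on ℓ vertices gets the potential (n + 1) ^ (n + 1 - ℓ);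
-- its at most n extensions together have less, so the total potential drops.
module Submission where

open import Defs
open import Data.Bool.Properties using (T-irrelevant)
open import Data.Fin using (Fin)
import Data.Fin.Properties as Fin
open import Data.List using (List; []; _∷_; _++_; _∷ʳ_; length; map; mapMaybe; allFin)
open import Data.List.Membership.Propositional using (_∈_; _∉_; lose)
open import Data.List.Membership.Propositional.Properties using (∈-∃++; ∈-++⁺ˡ; ∈-++⁺ʳ; ∈-++⁻; ∈-allFin)
import Data.List.Membership.DecPropositional as DecMembership
open import Data.List.Properties using (length-++; length-mapMaybe; length-tabulate; map-++)
open import Data.List.Relation.Binary.Permutation.Propositional using (_↭_; ↭-refl; ↭-sym; ↭-trans; prep; ↭⇒↭ₛ)
open import Data.List.Relation.Binary.Permutation.Propositional.Properties using (All-resp-↭; Any-resp-↭; ∈-resp-↭; shift; ↭-length; map⁺)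
import Data.List.Relation.Binary.Permutation.Setoid.Properties as PermSetoid
open import Data.List.Relation.Unary.All as All using (All; []; _∷_)
import Data.List.Relation.Unary.All.Properties as All
open import Data.List.Relation.Unary.AllPairs as AllPairs using (AllPairs; []; _∷_)
import Data.List.Relation.Unary.AllPairs.Properties as AllPairs
open import Data.List.Relation.Unary.Any using (Any; here; there)
import Data.List.Relation.Unary.Any.Properties as Any
open import Data.List.Relation.Unary.Unique.Propositional using (Unique)
import Data.List.Relation.Unary.Unique.Propositional.Properties as Unique
open import Data.Maybe using (Maybe; just; nothing)
open import Data.Nat using (ℕ; suc; z≤n; s≤s; _∸_; _^_; _⊔_; _<_; _<?_) renaming (_≤_ to _≤ℕ_; _+_ to _+ℕ_; _*_ to _*ℕ_)
open import Data.Nat.Induction using (<-wellFounded)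
open import Data.Nat.ListAction using (sum)
open import Data.Nat.ListAction.Properties using (sum-++; sum-↭)
import Data.Nat.Properties as ℕ
open import Data.Product using (∃; ∃₂; _×_; _,_; proj₁; proj₂)
open import Data.Rational as ℚ using (0ℚ; ½)
import Data.Rational.Properties as ℚ
open import Data.Rational.Solver using (module +-*-Solver)
open import Data.Sum using (_⊎_; inj₁; inj₂)
open import Function using (_∘_; flip)
open import Induction.WellFounded using (Acc; acc)
open import Relation.Binary.Construct.Closure.ReflexiveTransitive as Star using (_◅_)
open import Relation.Binary.Definitions using (Symmetric)
open import Relation.Binary.PropositionalEquality using (_≡_; _≢_; refl; sym; trans; cong; cong₂; subst; setoid; resp₂)
open import Relation.Nullary using (¬_; yes; no; contradiction)
open import Relation.Nullary.Decidable using (T?)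

-- Order on the reals

p≤p+ε : ∀ p {ε} → 0ℚ ℚ.< ε → p ℚ.≤ p ℚ.+ ε
p≤p+ε p {ε} 0<ε = subst (ℚ._≤ p ℚ.+ ε) (ℚ.+-identityʳ p) (ℚ.+-monoʳ-≤ p (ℚ.<⇒≤ 0<ε))

p≤∣p∣ : ∀ p → p ℚ.≤ ℚ.∣ p ∣
p≤∣p∣ p with ℚ.≤-total 0ℚ p
... | inj₁ 0≤p = ℚ.≤-reflexive (sym (ℚ.0≤p⇒∣p∣≡p 0≤p))
... | inj₂ p≤0 = ℚ.≤-trans p≤0 (ℚ.0≤∣p∣ p)

∣p-q∣<δ⇒p<q+δ : ∀ p q {δ} → ℚ.∣ p ℚ.- q ∣ ℚ.< δ → p ℚ.< q ℚ.+ δ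
∣p-q∣<δ⇒p<q+δ p q {δ} h = begin-strict
  p                       ≡⟨ solve 2 (λ p q → p := q :+ (p :- q)) refl p q ⟩
  q ℚ.+ (p ℚ.- q)         ≤⟨ ℚ.+-monoʳ-≤ q (p≤∣p∣ (p ℚ.- q)) ⟩
  q ℚ.+ ℚ.∣ p ℚ.- q ∣     <⟨ ℚ.+-monoʳ-< q h ⟩
  q ℚ.+ δ                 ∎
  where
  open ℚ.≤-Reasoning
  open +-*-Solver

+-cancelʳ-≤ : ∀ r {p q} → p ℚ.+ r ℚ.≤ q ℚ.+ r → p ℚ.≤ q
+-cancelʳ-≤ r {p} {q} h = begin
  p                  ≡⟨ solve 2 (λ p r → p := (p :+ r) :- r) refl p r ⟩
  (p ℚ.+ r) ℚ.- r    ≤⟨ ℚ.+-monoˡ-≤ (ℚ.- r) h ⟩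
  (q ℚ.+ r) ℚ.- r    ≡⟨ solve 2 (λ q r → (q :+ r) :- r := q) refl q r ⟩
  q                  ∎
  where
  open ℚ.≤-Reasoning
  open +-*-Solver

≤-trans : ∀ {x y z} → x ≤ y → y ≤ z → x ≤ z
≤-trans {x} {y} {z} x≤y y≤z ε 0<ε
  with x≤y (½ ℚ.* ε) (½ε>0 0<ε) | y≤z (½ ℚ.* ε) (½ε>0 0<ε)
... | M , hxy | N , hyz = M ⊔ N , λ n n≥ → begin
  seq x n                                    ≤⟨ hxy n (ℕ.m⊔n≤o⇒m≤o M N n≥) ⟩
  seq y n ℚ.+ ½ ℚ.* ε                        ≤⟨ ℚ.+-monoˡ-≤ _ (hyz n (ℕ.m⊔n≤o⇒n≤o M N n≥)) ⟩
  (seq z n ℚ.+ ½ ℚ.* ε) ℚ.+ ½ ℚ.* ε          ≡⟨ ℚ.+-assoc (seq z n) _ _ ⟩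
  seq z n ℚ.+ (½ ℚ.* ε ℚ.+ ½ ℚ.* ε)          ≡⟨ cong (seq z n ℚ.+_) (½ε+½ε≡ε ε) ⟩
  seq z n ℚ.+ ε                              ∎
  where open ℚ.≤-Reasoning

x≤x+y : ∀ {x y} → 0ℝ ≤ y → x ≤ x + y
x≤x+y {x} {y} 0≤y ε 0<ε with 0≤y ε 0<ε
... | N , h = N , λ n n≥ → begin
  seq x n                          ≡⟨ ℚ.+-identityʳ (seq x n) ⟨
  seq x n ℚ.+ 0ℚ                   ≤⟨ ℚ.+-monoʳ-≤ (seq x n) (h n n≥) ⟩
  seq x n ℚ.+ (seq y n ℚ.+ ε)      ≡⟨ ℚ.+-assoc (seq x n) _ _ ⟨
  (seq x n ℚ.+ seq y n) ℚ.+ ε      ∎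
  where open ℚ.≤-Reasoning

-- Compare y and x at one index N past which both vary by less than ε / 4:
-- either y ≤ x up to ε from N on, or x stays below y from N on.
≰⇒≥ : ∀ {x y} → ¬ (x ≤ y) → y ≤ x
≰⇒≥ {x} {y} x≰y ε 0<ε = atN (seq y N ℚ.≤? seq x N ℚ.+ ½ε)
  where
  open ℚ.≤-Reasoning
  ½ε = ½ ℚ.* ε
  δ  = ½ ℚ.* ½ε
  cx = cauchy x δ (½ε>0 (½ε>0 0<ε))
  cy = cauchy y δ (½ε>0 (½ε>0 0<ε))
  N = proj₁ cx ⊔ proj₁ cy

  near : ∀ z (c : ∃ λ K → ∀ m n → K ≤ℕ m → K ≤ℕ n → ℚ.∣ seq z m ℚ.- seq z n ∣ ℚ.< δ) →
         ∀ {m n} → proj₁ c ≤ℕ m → proj₁ c ≤ℕ n → seq z m ℚ.≤ seq z n ℚ.+ δ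
  near z (_ , h) m≥ n≥ = ℚ.<⇒≤ (∣p-q∣<δ⇒p<q+δ (seq z _) (seq z _) (h _ _ m≥ n≥))

  xN≥ : proj₁ cx ≤ℕ N
  xN≥ = ℕ.m≤m⊔n _ _
  yN≥ : proj₁ cy ≤ℕ N
  yN≥ = ℕ.m≤n⊔m _ _

  atN : _ → _
  atN (yes yN≤) = N , λ n n≥ → begin
    seq y n                                  ≤⟨ near y cy (ℕ.≤-trans yN≥ n≥) yN≥ ⟩
    seq y N ℚ.+ δ                            ≤⟨ ℚ.+-monoˡ-≤ δ yN≤ ⟩
    (seq x N ℚ.+ ½ε) ℚ.+ δ                   ≤⟨ ℚ.+-monoˡ-≤ δ (ℚ.+-monoˡ-≤ ½ε (near x cx xN≥ (ℕ.≤-trans xN≥ n≥))) ⟩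
    ((seq x n ℚ.+ δ) ℚ.+ ½ε) ℚ.+ δ           ≡⟨ regroup (seq x n) δ ½ε ⟩
    seq x n ℚ.+ ((δ ℚ.+ δ) ℚ.+ ½ε)           ≡⟨ cong (λ η → seq x n ℚ.+ (η ℚ.+ ½ε)) (½ε+½ε≡ε ½ε) ⟩
    seq x n ℚ.+ (½ε ℚ.+ ½ε)                  ≡⟨ cong (seq x n ℚ.+_) (½ε+½ε≡ε ε) ⟩
    seq x n ℚ.+ ε                            ∎
    where
    regroup : ∀ a b c → ((a ℚ.+ b) ℚ.+ c) ℚ.+ b ≡ a ℚ.+ ((b ℚ.+ b) ℚ.+ c)
    regroup = solve 3 (λ a b c → ((a :+ b) :+ c) :+ b := a :+ ((b :+ b) :+ c)) refl
      where open +-*-Solver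
  atN (no yN≰) = contradiction x≤y x≰y
    where
    x≤y : x ≤ y
    x≤y η 0<η = N , λ n n≥ → ℚ.≤-trans (+-cancelʳ-≤ δ (begin
      seq x n ℚ.+ δ                ≤⟨ ℚ.+-monoˡ-≤ δ (near x cx (ℕ.≤-trans xN≥ n≥) xN≥) ⟩
      (seq x N ℚ.+ δ) ℚ.+ δ        ≡⟨ ℚ.+-assoc (seq x N) δ δ ⟩
      seq x N ℚ.+ (δ ℚ.+ δ)        ≡⟨ cong (seq x N ℚ.+_) (½ε+½ε≡ε ½ε) ⟩
      seq x N ℚ.+ ½ε               ≤⟨ ℚ.<⇒≤ (ℚ.≰⇒> yN≰) ⟩
      seq y N                      ≤⟨ near y cy yN≥ (ℕ.≤-trans yN≥ n≥) ⟩
      seq y n ℚ.+ δ                ∎)) (p≤p+ε (seq y n) 0<η)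

-- Lists

module _ {A : Set} where

  AllPairs-resp-↭ : ∀ {R : A → A → Set} → Symmetric R →
                    ∀ {xs ys} → xs ↭ ys → AllPairs R xs → AllPairs R ys
  AllPairs-resp-↭ {R} R-sym xs↭ys =
    PermSetoid.AllPairs-resp-↭ (setoid A) R-sym (resp₂ R) (↭⇒↭ₛ xs↭ys)

  Unique-∷ʳ⁺ : ∀ {xs} {x : A} → Unique xs → x ∉ xs → Unique (xs ∷ʳ x)
  Unique-∷ʳ⁺ xs! x∉xs = Unique.++⁺ xs! ([] ∷ []) λ { (x∈xs , here refl) → x∉xs x∈xs }

  Unique-∷ʳ⁻ : ∀ xs {x : A} → Unique (xs ∷ʳ x) → Unique xs × x ∉ xs
  Unique-∷ʳ⁻ []       _             = [] , λ ()
  Unique-∷ʳ⁻ (y ∷ xs) (y≢ ∷ xs!) with All.∷ʳ⁻ y≢ | Unique-∷ʳ⁻ xs xs!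
  ... | y∉xs , y≢x | xs!′ , x∉xs =
    y∉xs ∷ xs!′ , λ { (here x≡y) → y≢x (sym x≡y) ; (there x∈xs) → x∉xs x∈xs }

  length-∷ʳ : ∀ xs (x : A) → length (xs ∷ʳ x) ≡ suc (length xs)
  length-∷ʳ xs x = trans (length-++ xs) (ℕ.+-comm (length xs) 1)

  -- Pigeonhole by induction on `xs`: one occurrence of the head is deleted from `ys`, and the tail,
  -- being free of the head, stays included in what remains.
  Unique-⊆⇒length≤ : ∀ {xs ys : List A} → Unique xs → (∀ {x} → x ∈ xs → x ∈ ys) →
                     length xs ≤ℕ length ys
  Unique-⊆⇒length≤ []           _  = z≤n
  Unique-⊆⇒length≤ {x ∷ xs} (x≢ ∷ xs!) xs⊆ys with ∈-∃++ (xs⊆ys (here refl))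
  ... | as , bs , refl = ℕ.≤-trans
    (s≤s (Unique-⊆⇒length≤ xs! λ {y} y∈xs → remove y∈xs (∈-resp-↭ (shift x as bs) (xs⊆ys (there y∈xs)))))
    (ℕ.≤-reflexive (sym (↭-length (shift x as bs))))
    where
    remove : ∀ {y} → y ∈ xs → y ∈ x ∷ as ++ bs → y ∈ as ++ bs
    remove y∈xs (here refl) = contradiction refl (All.lookup x≢ y∈xs)
    remove y∈xs (there y∈)  = y∈

  sum-map-const : ∀ {f : A → ℕ} {c xs} → All (λ x → f x ≡ c) xs →
                  sum (map f xs) ≡ length xs *ℕ c
  sum-map-const []         = refl
  sum-map-const (fx≡c ∷ h) = cong₂ _+ℕ_ fx≡c (sum-map-const h)

  -- Since `f m ≤ f x` cannot be decided for the minimum `m` of the tail, it is refuted instead: it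
  -- would make `m` a minimum of the whole list. Then `≰⇒≥` yields `f x ≤ f m`, and `x` itself is a
  -- minimum.
  ¬¬-minimum : ∀ (f : A → ℝ) x xs →
               ¬ ¬ ∃₂ λ m rest → x ∷ xs ↭ m ∷ rest × All (λ y → f m ≤ f y) rest
  ¬¬-minimum f x []       ¬min = ¬min (x , [] , ↭-refl , [])
  ¬¬-minimum f x (y ∷ ys) ¬min = ¬¬-minimum f y ys λ (m , rest , p , m≤) →
    let m≰x = λ m≤x → ¬min (m , x ∷ rest , ↭-trans (prep x p) (_↭_.swap x m ↭-refl) , m≤x ∷ m≤)
        x≤m = ≰⇒≥ {f m} {f x} m≰x
    in ¬min (x , y ∷ ys , ↭-refl ,
             All-resp-↭ (↭-sym p) (x≤m ∷ All.map (λ {z} → ≤-trans {f x} {f m} {f z} x≤m) m≤))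

  module _ {B : Set} {f : A → Maybe B} where

    All-mapMaybe : ∀ {P : B → Set} → (∀ {x b} → f x ≡ just b → P b) →
                   ∀ xs → All P (mapMaybe f xs)
    All-mapMaybe Pf []       = []
    All-mapMaybe Pf (x ∷ xs) with f x in eq
    ... | just b  = Pf eq ∷ All-mapMaybe Pf xs
    ... | nothing = All-mapMaybe Pf xs

    ∈-mapMaybe : ∀ {xs x b} → x ∈ xs → f x ≡ just b → b ∈ mapMaybe f xs
    ∈-mapMaybe (here refl) eq rewrite eq = here refl
    ∈-mapMaybe {y ∷ _} (there x∈xs) eq with f y
    ... | just _  = there (∈-mapMaybe x∈xs eq)
    ... | nothing = ∈-mapMaybe x∈xs eq

    AllPairs-mapMaybe : ∀ {S : B → B → Set} →
      (∀ {x y a b} → x ≢ y → f x ≡ just a → f y ≡ just b → S a b) →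
      ∀ {xs} → Unique xs → AllPairs S (mapMaybe f xs)
    AllPairs-mapMaybe Sf [] = []
    AllPairs-mapMaybe {S} Sf {x ∷ _} (x≢ ∷ xs!) with f x in eq
    ... | nothing = AllPairs-mapMaybe Sf xs!
    ... | just a  = heads x≢ ∷ AllPairs-mapMaybe Sf xs!
      where
      heads : ∀ {ys} → All (x ≢_) ys → All (S a) (mapMaybe f ys)
      heads []                 = []
      heads {y ∷ _} (x≢y ∷ x≢) with f y in eq′
      ... | just b  = Sf x≢y eq eq′ ∷ heads x≢
      ... | nothing = heads x≢

module _ {n : ℕ} {G : WeightedDigraph n} {r : Fin n} where
  open WeightedDigraph G

  -- The prefix order on paths

  infix 4 _≼_

  data _≼_ {u} (P : Path G r u) : ∀ {v} → Path G r v → Set where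
    here : P ≼ P
    step : ∀ {v w} {Q : Path G r v} {e : Edge v w} → P ≼ Q → P ≼ Q ⊕ e

  size : ∀ {v} → Path G r v → ℕ
  size P = length (vertices P)

  size-⊕ : ∀ {v u} (P : Path G r v) (e : Edge v u) → size (P ⊕ e) ≡ suc (size P)
  size-⊕ P e = length-∷ʳ (vertices P) _

  ≼⇒size≤ : ∀ {u v} {P : Path G r u} {Q : Path G r v} → P ≼ Q → size P ≤ℕ size Q
  ≼⇒size≤ here = ℕ.≤-refl
  ≼⇒size≤ (step {Q = Q} {e} P≼Q) =
    ℕ.≤-trans (≼⇒size≤ P≼Q) (ℕ.≤-trans (ℕ.n≤1+n _) (ℕ.≤-reflexive (sym (size-⊕ Q e))))

  -- An extension has one vertex more, while a prefix is never longer than the whole.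
  ⊕⋠ : ∀ {v u} {P : Path G r v} {e : Edge v u} → ¬ (P ⊕ e ≼ P)
  ⊕⋠ {P = P} {e} P⊕e≼P = ℕ.<-irrefl refl (subst (_≤ℕ size P) (size-⊕ P e) (≼⇒size≤ P⊕e≼P))

  ⊕≼⇒≼ : ∀ {v u w} {P : Path G r v} {e : Edge v u} {Q : Path G r w} → P ⊕ e ≼ Q → P ≼ Q
  ⊕≼⇒≼ here         = step here
  ⊕≼⇒≼ (step P⊕e≼Q) = step (⊕≼⇒≼ P⊕e≼Q)

  ≼-simple : ∀ {u v} {P : Path G r u} {Q : Path G r v} → P ≼ Q → Simple Q → Simple P
  ≼-simple here               Q! = Q!
  ≼-simple (step {Q = Q} P≼Q) Q! = ≼-simple P≼Q (proj₁ (Unique-∷ʳ⁻ (vertices Q) Q!))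

  -- A proof of `P ≼ Q` peels edges off the end of `Q`. This view exposes instead the edge that
  -- follows `P` inside `Q`, which is the one the algorithm appends when it pops `P`.
  data Next {u} (P : Path G r u) : ∀ {v} → Path G r v → Set where
    same   : Next P P
    beyond : ∀ {v w} {Q : Path G r v} (e : Edge u w) → P ⊕ e ≼ Q → Next P Q

  next : ∀ {u v} {P : Path G r u} {Q : Path G r v} → P ≼ Q → Next P Q
  next here = same
  next (step {e = e} P≼Q) with next P≼Q
  ... | same           = beyond e here
  ... | beyond e′ P⊕e≼ = beyond e′ (step P⊕e≼)

  simple⇒size≤n : ∀ {v} {P : Path G r v} → Simple P → size P ≤ℕ n
  simple⇒size≤n {P = P} P! = subst (size P ≤ℕ_) (length-tabulate {n = n} (λ i → i))
    (Unique-⊆⇒length≤ P! λ _ → ∈-allFin _)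

module _ {n : ℕ} (G : WeightedDigraph n) (r : Fin n) (k : ℕ) where
  open WeightedDigraph G
  open ExhSkSSP G r k
  open DecMembership (Fin._≟_ {n}) using (_∈?_)

  -- Extensions of a path

  -- The graph of the successful calls of `extension`: matching on it reveals the edge, the
  -- freshness of `u` and the key without repeating the two decisions.
  data ExtendsBy {v} (Π : Path G r v) (u : Fin n) : Entry → Set where
    extendsBy : (e : Edge v u) → u ∉ vertices Π → ExtendsBy Π u (entry (Π ⊕ e) (weight (Π ⊕ e)))

  extension-sound : ∀ {v} (Π : Path G r v) {u x} → extension Π u ≡ just x → ExtendsBy Π u x
  extension-sound {v} Π {u} eq with T? (E v u) | u ∈? vertices Π
  extension-sound Π refl | yes e | no u∉ = extendsBy e u∉

  extension-complete : ∀ {v u} (Π : Path G r v) → Edge v u → u ∉ vertices Π →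
                       ∃ λ x → extension Π u ≡ just x
  extension-complete {v} {u} Π e u∉ with T? (E v u) | u ∈? vertices Π
  ... | yes _ | no _   = _ , refl
  ... | yes _ | yes u∈ = contradiction u∈ u∉
  ... | no ¬e | _      = contradiction e ¬e

  Any-extensions : ∀ {v u w} (Π : Path G r v) {P : Path G r w} (e : Edge v u) →
                   u ∉ vertices Π → Π ⊕ e ≼ P → Any (λ x → path x ≼ P) (extensions Π)
  Any-extensions {v} {u} Π {P} e u∉ Π⊕e≼P with extension-complete Π e u∉
  ... | _ , eq = lose (∈-mapMaybe {f = extension Π} (∈-allFin u) eq) (prefix (extension-sound Π eq))
    where
    prefix : ∀ {x} → ExtendsBy Π u x → path x ≼ P
    -- The edge witness found by `T?` need not be `e` on the nose; irrelevance identifies the two.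
    prefix (extendsBy e′ _) rewrite T-irrelevant {E v u} e e′ = Π⊕e≼P

  All-extensions : ∀ {v} (Π : Path G r v) {P : Entry → Set} →
                   (∀ {u x} → ExtendsBy Π u x → P x) → All P (extensions Π)
  All-extensions Π h = All-mapMaybe (h ∘ extension-sound Π) (allFin n)

  Incomparable : Entry → Entry → Set
  Incomparable x y = ¬ (path x ≼ path y) × ¬ (path y ≼ path x)

  Incomparable-sym : Symmetric Incomparable
  Incomparable-sym (x⋠y , y⋠x) = y⋠x , x⋠y

  -- If one extension of `Π` were a prefix of another, either both would coincide, against their
  -- distinct last vertices, or the first would be a prefix of `Π`, against `⊕⋠`.
  extensions-incomparable : ∀ {v} (Π : Path G r v) → AllPairs Incomparable (extensions Π)
  extensions-incomparable Π =
    AllPairs-mapMaybe (λ u≢w eq eq′ →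
      let ex = extension-sound Π eq ; ey = extension-sound Π eq′ in
      apart u≢w ex ey , apart (u≢w ∘ sym) ey ex) (Unique.allFin⁺ n)
    where
    apart : ∀ {u w x y} → u ≢ w → ExtendsBy Π u x → ExtendsBy Π w y → ¬ (path x ≼ path y)
    apart u≢w (extendsBy e _) (extendsBy e′ _) here     = u≢w refl
    apart u≢w (extendsBy e _) (extendsBy e′ _) (step p) = ⊕⋠ p

  -- Effect of one iteration on the lists

  -- The three outcomes of `recordPath` at `u`. The resulting list is an index, so that abstracting
  -- it together with the view replaces it by its actual value in each case.
  data RecordView {v} (Π : Path G r v) (Ts : Lists) : (u : Fin n) → List (Path G r u) → Set where
    other : ∀ {u} → v ≢ u → RecordView Π Ts u (Ts u)
    full  : k ≤ℕ length (Ts v) → RecordView Π Ts v (Ts v)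
    added : length (Ts v) < k → RecordView Π Ts v (Ts v ∷ʳ Π)

  recordView : ∀ {v} (Π : Path G r v) Ts u → RecordView Π Ts u (recordPath Π Ts u)
  recordView {v} Π Ts u with v Fin.≟ u
  ... | no v≢u = other v≢u
  ... | yes refl with length (Ts v) <? k
  ...   | yes <k = added <k
  ...   | no ≮k  = full (ℕ.≮⇒≥ ≮k)

  ∈-recordPath⁻ : ∀ {v} (Π : Path G r v) Ts (P : ∀ {u} → Path G r u → Set) →
                  (∀ {u} {Q : Path G r u} → Q ∈ Ts u → P Q) → P Π →
                  ∀ {u} {Q : Path G r u} → Q ∈ recordPath Π Ts u → P Q
  ∈-recordPath⁻ Π Ts P old new {u} Q∈ with recordPath Π Ts u | recordView Π Ts u
  ... | _ | other _ = old Q∈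
  ... | _ | full _  = old Q∈
  ... | _ | added _ with ∈-++⁻ (Ts u) Q∈
  ...   | inj₁ Q∈Ts        = old Q∈Ts
  ...   | inj₂ (here refl) = new

  -- The meaning of being rightly discarded: the list has reached its final length `k`, and nothing
  -- in it is heavier than `P`.
  Dominated : Lists → ∀ {v} → Path G r v → Set
  Dominated Ts {v} P = length (Ts v) ≡ k × (∀ {Q} → Q ∈ Ts v → weight Q ≤ weight P)

  Settled : Lists → ∀ {v} → Path G r v → Set
  Settled Ts {v} P = P ∈ Ts v ⊎ Dominated Ts P

  -- Lists only grow, and a list that dominates something is full, so it no longer changes.
  recordPath-Settled : ∀ {v} (Π : Path G r v) Ts {u} {P : Path G r u} →
                       Settled Ts P → Settled (recordPath Π Ts) P
  recordPath-Settled Π Ts {u} settled with recordPath Π Ts u | recordView Π Ts u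
  recordPath-Settled Π Ts settled                | _ | other _  = settled
  recordPath-Settled Π Ts settled                | _ | full _   = settled
  recordPath-Settled Π Ts (inj₁ P∈)              | _ | added _  = inj₁ (∈-++⁺ˡ P∈)
  recordPath-Settled Π Ts (inj₂ (len≡k , _))     | _ | added <k = contradiction len≡k (ℕ.<⇒≢ <k)

  -- Invariants of the loop

  -- The key is fixed by the index, so matching on `valid` turns the stored key into the weight of
  -- the path.
  data Valid : Entry → Set where
    valid : ∀ {v} {P : Path G r v} → Simple P → Valid (entry P (weight P))

  Valid⇒Simple : ∀ {x} → Valid x → Simple (path x)
  Valid⇒Simple (valid P!) = P!

  -- `lists-done` excludes prefixes and not merely equality: otherwise a later extension of a queued
  -- path could reproduce a recorded one. `covered` drives correctness; it says that no simple path
  -- is ever lost.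
  record Invariant (s : State) : Set where
    field
      queue-valid        : All Valid (queue s)
      queue-incomparable : AllPairs Incomparable (queue s)
      lists-unique       : ∀ v → Unique (lists s v)
      lists-simple       : ∀ {v} {Q : Path G r v} → Q ∈ lists s v → Simple Q
      lists-length       : ∀ v → length (lists s v) ≤ℕ k
      lists-done         : ∀ {v} {Q : Path G r v} → Q ∈ lists s v →
                           All (λ x → ¬ (path x ≼ Q)) (queue s)
      lists-lightest     : ∀ {v} {Q : Path G r v} → Q ∈ lists s v →
                           All (λ x → weight Q ≤ key x) (queue s)
      covered            : ∀ {v} {P : Path G r v} → Simple P →
                           Settled (lists s) P ⊎ Any (λ x → path x ≼ P) (queue s)

  open Invariant

  trivial-≼ : ∀ {v} (P : Path G r v) → trivial ≼ P
  trivial-≼ trivial = here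
  trivial-≼ (P ⊕ _) = step (trivial-≼ P)

  initial-invariant : Invariant initial
  initial-invariant = record
    { queue-valid        = valid ([] ∷ []) ∷ []
    ; queue-incomparable = [] ∷ []
    ; lists-unique       = λ _ → []
    ; lists-simple       = λ ()
    ; lists-length       = λ _ → z≤n
    ; lists-done         = λ ()
    ; lists-lightest     = λ ()
    ; covered            = λ {_} {P} _ → inj₂ (here (trivial-≼ P))
    }

  -- Preservation of the invariant by one iteration

  module _ {Ts q rest v} {Π : Path G r v} (I : Invariant ⟨ Ts , q ⟩)
           (q↭ : q ↭ entry Π (weight Π) ∷ rest)
           (Π≤ : All (λ x → weight Π ≤ key x) rest) (Π! : Simple Π) where

    private
      Ts′ = recordPath Π Ts

      Π∷rest∥ : AllPairs Incomparable (entry Π (weight Π) ∷ rest)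
      Π∷rest∥ = AllPairs-resp-↭ (λ {x} {y} → Incomparable-sym {x} {y}) q↭ (queue-incomparable I)

      Π∥rest : All (Incomparable (entry Π (weight Π))) rest
      Π∥rest = AllPairs.head Π∷rest∥

      popped : ∀ {P : Entry → Set} → All P q → P (entry Π (weight Π)) × All P rest
      popped h with All-resp-↭ q↭ h
      ... | p ∷ ps = p , ps

      weight≤extension : ∀ {u x} → ExtendsBy Π u x → weight Π ≤ key x
      weight≤extension (extendsBy e _) = x≤x+y {weight Π} {ω e} (ω-nonNeg e)

      incomparable′ : AllPairs Incomparable (extensions Π ++ rest)
      incomparable′ = AllPairs.++⁺ (extensions-incomparable Π) (AllPairs.tail Π∷rest∥)
                        (All-extensions Π λ ex → All.map (λ {y} → ext∥ {y = y} ex) Π∥rest)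
        where
        -- A prefix of `Π ⊕ e` is either `Π ⊕ e` itself, which has `Π` as a prefix, or a prefix of
        -- `Π`. Both contradict the incomparability of `Π` and `y`.
        ext∥ : ∀ {u x y} → ExtendsBy Π u x → Incomparable (entry Π (weight Π)) y → Incomparable x y
        ext∥ {y = y} (extendsBy e _) (Π⋠y , y⋠Π) = Π⋠y ∘ ⊕≼⇒≼ , y⋠
          where
          y⋠ : ¬ (path y ≼ Π ⊕ e)
          y⋠ here     = Π⋠y (step here)
          y⋠ (step p) = y⋠Π p

      unique′ : ∀ u → Unique (Ts′ u)
      unique′ u with Ts′ u | recordView Π Ts u
      ... | _ | other _ = lists-unique I u
      ... | _ | full _  = lists-unique I u
      -- Were `Π` already recorded, `lists-done` would forbid the queued `Π` to be a prefix of
      -- itself.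
      ... | _ | added _ = Unique-∷ʳ⁺ (lists-unique I u) λ Π∈ → proj₁ (popped (lists-done I Π∈)) here

      length′ : ∀ u → length (Ts′ u) ≤ℕ k
      length′ u with Ts′ u | recordView Π Ts u
      ... | _ | other _  = lists-length I u
      ... | _ | full _   = lists-length I u
      ... | _ | added <k = subst (_≤ℕ k) (sym (length-∷ʳ (Ts u) Π)) <k

      done-old : ∀ {u} {Q : Path G r u} → Q ∈ Ts u →
                 All (λ x → ¬ (path x ≼ Q)) (extensions Π ++ rest)
      done-old Q∈ with popped (lists-done I Q∈)
      ... | Π⋠Q , rest⋠Q = All.++⁺ (All-extensions Π λ { (extendsBy _ _) → Π⋠Q ∘ ⊕≼⇒≼ }) rest⋠Q

      done-new : All (λ x → ¬ (path x ≼ Π)) (extensions Π ++ rest)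
      done-new = All.++⁺ (All-extensions Π λ { (extendsBy _ _) → ⊕⋠ }) (All.map proj₂ Π∥rest)

      lightest-new : All (λ x → weight Π ≤ key x) (extensions Π ++ rest)
      lightest-new = All.++⁺ (All-extensions Π weight≤extension) Π≤

      lightest-old : ∀ {u} {Q : Path G r u} → Q ∈ Ts u →
                     All (λ x → weight Q ≤ key x) (extensions Π ++ rest)
      lightest-old {Q = Q} Q∈ =
        All.map (λ {x} → ≤-trans {weight Q} {weight Π} {key x} (proj₁ (popped (lists-lightest I Q∈))))
                lightest-new

      Π-settled : Settled Ts′ Π
      Π-settled with Ts′ v | recordView Π Ts v
      ... | _ | other v≢v = contradiction refl v≢v
      -- Before the pop `Π` was itself queued, so `lists-lightest` already bounds the full list by
      -- its weight.
      ... | _ | full k≤   = inj₂ (ℕ.≤-antisym (lists-length I v) k≤ ,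
                                  λ Q∈ → proj₁ (popped (lists-lightest I Q∈)))
      ... | _ | added _   = inj₁ (∈-++⁺ʳ (Ts v) (here refl))

      -- Only the paths whose waiting prefix is the popped `Π` need a new witness: `Π` itself has
      -- just been settled, and any longer path continues through one of the inserted extensions.
      covered′ : ∀ {u} {P : Path G r u} → Simple P →
                 Settled Ts′ P ⊎ Any (λ x → path x ≼ P) (extensions Π ++ rest)
      covered′ P! with covered I P!
      ... | inj₁ settled = inj₁ (recordPath-Settled Π Ts settled)
      ... | inj₂ queued with Any-resp-↭ q↭ queued
      ...   | there in-rest = inj₂ (Any.++⁺ʳ (extensions Π) in-rest)
      ...   | here Π≼P with next Π≼P
      ...     | same          = inj₁ Π-settled
      ...     | beyond e Π⊕e≼ = inj₂ (Any.++⁺ˡ (Any-extensions Π e u∉ Π⊕e≼))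
        -- Prefixes of the simple path `P` are simple, so the next vertex is not on `Π` and the
        -- algorithm does insert this extension.
        where u∉ = proj₂ (Unique-∷ʳ⁻ (vertices Π) (≼-simple Π⊕e≼ P!))

    iterate-invariant : Invariant ⟨ Ts′ , extensions Π ++ rest ⟩
    iterate-invariant = record
      { queue-valid        = All.++⁺ (All-extensions Π λ { (extendsBy _ u∉) → valid (Unique-∷ʳ⁺ Π! u∉) })
                                     (proj₂ (popped (queue-valid I)))
      ; queue-incomparable = incomparable′
      ; lists-unique       = unique′
      ; lists-simple       = ∈-recordPath⁻ Π Ts Simple (lists-simple I) Π!
      ; lists-length       = length′
      ; lists-done         = ∈-recordPath⁻ Π Ts (λ Q → All (λ x → ¬ (path x ≼ Q)) (extensions Π ++ rest))
                                           done-old done-new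
      ; lists-lightest     = ∈-recordPath⁻ Π Ts (λ Q → All (λ x → weight Q ≤ key x) (extensions Π ++ rest))
                                           lightest-old lightest-new
      ; covered            = covered′
      }

  ⟶-invariant : ∀ {s s′} → s ⟶ s′ → Invariant s → Invariant s′
  ⟶-invariant (iterate q↭ κ≤) I with All-resp-↭ q↭ (queue-valid I)
  ... | valid Π! ∷ _ = iterate-invariant I q↭ κ≤ Π!

  ⟶*-invariant : ∀ {s s′} → s ⟶* s′ → Invariant s → Invariant s′
  ⟶*-invariant Star.ε        I = I
  ⟶*-invariant (st ◅ sts) I = ⟶*-invariant sts (⟶-invariant st I)

  -- Termination

  potential : Entry → ℕ
  potential x = suc n ^ (suc n ∸ size (path x))

  potentials : List Entry → ℕ
  potentials q = sum (map potential q)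

  potentials-++ : ∀ xs ys → potentials (xs ++ ys) ≡ potentials xs +ℕ potentials ys
  potentials-++ xs ys = trans (cong sum (map-++ potential xs ys)) (sum-++ (map potential xs) _)

  extensions-potential : ∀ {v} (Π : Path G r v) κ → Simple Π →
                         potentials (extensions Π) < potential (entry Π κ)
  extensions-potential Π κ Π! = begin-strict
    potentials (extensions Π)    ≡⟨ sum-map-const (All-extensions Π each) ⟩
    length (extensions Π) *ℕ c   ≤⟨ ℕ.*-monoˡ-≤ c (length-mapMaybe (extension Π) (allFin n)) ⟩
    length (allFin n) *ℕ c       ≡⟨ cong (_*ℕ c) (length-tabulate {n = n} (λ i → i)) ⟩
    -- The right-hand side unfolds to `c +ℕ n *ℕ c`, and `c` is positive.
    n *ℕ c                       <⟨ ℕ.m<n+m (n *ℕ c) (ℕ.m^n>0 (suc n) (n ∸ size Π)) ⟩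
    -- Simplicity gives `size Π ≤ℕ n`, so the truncated subtraction loses nothing.
    suc n ^ suc (n ∸ size Π)     ≡⟨ cong (suc n ^_) (ℕ.+-∸-assoc 1 (simple⇒size≤n {P = Π} Π!)) ⟨
    suc n ^ (suc n ∸ size Π)     ∎
    where
    open ℕ.≤-Reasoning
    c = suc n ^ (n ∸ size Π)

    each : ∀ {u x} → ExtendsBy Π u x → potential x ≡ c
    each (extendsBy e _) = cong (λ ℓ → suc n ^ (suc n ∸ ℓ)) (size-⊕ Π e)

  ⟶-potential : ∀ {s s′} → Invariant s → s ⟶ s′ → potentials (queue s′) < potentials (queue s)
  ⟶-potential I (iterate {q = q} {rest} {Π = Π} {κ} q↭ _) = begin-strict
    potentials (extensions Π ++ rest)              ≡⟨ potentials-++ (extensions Π) rest ⟩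
    potentials (extensions Π) +ℕ potentials rest   <⟨ ℕ.+-monoˡ-< (potentials rest) (extensions-potential Π κ Π!) ⟩
    potentials (entry Π κ ∷ rest)                  ≡⟨ sum-↭ (map⁺ potential q↭) ⟨
    potentials q                                   ∎
    where
    open ℕ.≤-Reasoning
    Π! : Simple Π
    Π! = Valid⇒Simple (All.head (All-resp-↭ q↭ (queue-valid I)))

  -- The invariant is carried along because the potential is only known to drop when the popped path
  -- is simple.
  terminates-from : ∀ {s} → Invariant s → Acc _<_ (potentials (queue s)) → Acc (flip _⟶_) s
  terminates-from I (acc rs) = acc λ st → terminates-from (⟶-invariant st I) (rs (⟶-potential I st))

  terminates : Terminates
  terminates = terminates-from initial-invariant (<-wellFounded _)

  -- Progress, and correctness once the queue is empty

  never-stuck : NeverStuck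
  never-stuck {⟨ _ , [] ⟩}    _ q≢[] _     = q≢[] refl
  never-stuck {⟨ _ , x ∷ q ⟩} _ _    stuck =
    ¬¬-minimum key x q λ (_ , _ , q↭ , min) → stuck (_ , iterate q↭ min)

  correct : CorrectAtTermination
  correct {⟨ Ts , [] ⟩} run refl v _ = record
    { distinct = lists-unique I v
    ; simple   = All.tabulate (lists-simple I)
    ; topK     = topK (length (Ts v) <? k)
    }
    where
    I : Invariant ⟨ Ts , [] ⟩
    I = ⟶*-invariant run initial-invariant

    settled : ∀ {P : Path G r v} → Simple P → Settled Ts P
    settled P! with covered I P!
    ... | inj₁ s  = s
    -- With an empty queue no prefix can be waiting.
    ... | inj₂ ()

    topK : _ → _
    -- A list shorter than `k` dominates nothing, so every simple path must have been recorded, and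
    -- the list bounds their number.
    topK (yes <k) = inj₁ (few , λ _ → all-in)
      where
      all-in : ∀ {P : Path G r v} → Simple P → P ∈ Ts v
      all-in P! with settled P!
      ... | inj₁ P∈          = P∈
      ... | inj₂ (len≡k , _) = contradiction len≡k (ℕ.<⇒≢ <k)

      few : FewerSimplePathsThan G k r v
      few Ps Ps! Ps-simple =
        ℕ.≤-<-trans (Unique-⊆⇒length≤ Ps! λ P∈ → all-in (All.lookup Ps-simple P∈)) <k
    topK (no ≮k) = inj₂
      -- The recorded list is itself a family of at least `k` distinct simple paths.
      ( (λ few → ≮k (few (Ts v) (lists-unique I v) (All.tabulate (lists-simple I))))
      , ℕ.≤-antisym (lists-length I v) (ℕ.≮⇒≥ ≮k)
      , lightest )
      where
      lightest : ∀ P → Simple P → P ∉ Ts v → ∀ Q → Q ∈ Ts v → weight Q ≤ weight P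
      lightest P P! P∉ Q Q∈ with settled P!
      ... | inj₁ P∈           = contradiction P∈ P∉
      ... | inj₂ (_ , weight≤) = weight≤ Q∈

theorem1 : ∀ {n : ℕ} (G : WeightedDigraph n) (r : Fin n) (k : ℕ) → 1 ≤ℕ k →
    let open ExhSkSSP G r k in
    Terminates × NeverStuck × CorrectAtTermination
theorem1 G r k _ = terminates G r k , never-stuck G r k , correct G r k
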